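{- Let $G$ be a finite connected graph with root $r$, let $\mathcal{P}=\{F_1,\dots,F_t\}$ be a partition of $E(G)$ into $t$ classes, let $A\in\mathbb{F}_2^{c\times t}$ be its cycle–class parity matrix with respect to a cycle basis $B_1,\dots,B_c$ of $G$, and let $\rho=\mathrm{rank}_{\mathbb{F}_2}(A)$. Then: (i) the most generic consistent assignment has dimension $k=t-\rho$, given by $g_j=\pi(e_j)$, the images of the standard basis $e_1,\dots,e_t$ of $\mathbb{Z}_2^t$ under the quotient map $\pi\colon\mathbb{Z}_2^t\to\mathbb{Z}_2^t/\mathrm{rowspan}(A)\cong\mathbb{Z}_2^k$; every other consistent assignment is a linear image of it; (ii) the labeling $\lambda(v)=\sum_{e\in P(r,v)}g_{\mathrm{class}(e)}$ under this assignment is conflict-free, i.e. independent of the choice of the path $P(r,v)$ from $r$ to $v$; (iii) with $S=\{g_j : g_j\neq 0\}$, every path of length $\ell$ in $G$ maps under $\lambda$ to a walk of length $\ell$ in $\mathrm{Cay}(\mathbb{Z}_2^k,S)$, so $d_{\mathrm{Cay}}(\lambda(u),\lambda(v))\le d_G(u,v)$ for all $u,v\in V(G)$: the only possible failure of isometry is a shortcut (a pair with $d_{\mathrm{Cay}}<d_G$), never a stretch (a pair with $d_{\mathrm{Cay}}>d_G$).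
   Context: $c=|E(G)|-|V(G)|+1$ is the cycle rank. A cycle basis is a set of $c$ cycles whose edge sets form a basis over $\mathbb{F}_2$ of the cycle space of $G$. The cycle–class parity matrix is $A[i,j]=|F_j\cap E(B_i)|\bmod 2$. $\mathrm{class}(e)=j$ is the index with $e\in F_j$. An assignment of elements $g_1,\dots,g_t\in\mathbb{Z}_2^{k'}$ (for some $k'$) to the classes is consistent if $\sum_i g_{\mathrm{class}(e_i)}=0$ for every cycle $(e_1,\dots,e_\ell)$ of $G$ (equivalently for every cycle of a cycle basis, i.e. $A(g_1\mid\cdots\mid g_t)^{\top}=0$ over $\mathbb{F}_2$). A consistent assignment $(g'_j)$ in $\mathbb{Z}_2^{k'}$ is a linear image of $(g_j)$ if there is a linear map $T\colon\mathbb{Z}_2^k\to\mathbb{Z}_2^{k'}$ with $g'_j=T(g_j)$ for all $j$. $\mathrm{Cay}(\Gamma,S)$, for an abelian group $\Gamma$ and a generating set $S=-S\subseteq\Gamma\setminus\{0\}$, is the graph on $\Gamma$ with edges $\{h,h+s\}$, $h\in\Gamma$, $s\in S$; $d_{\mathrm{Cay}}$ is its graph metric and $d_G$ is the shortest-path metric of $G$.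
   Formalization: In (iii), a path of length ℓ maps to a walk of length ℓ in the Cayley graph only if no edge on it has g_class(e) = 0; otherwise such edges become stationary steps. The literal claim fails for a triangle with one class (k = 0, S empty). The distance inequality is unaffected. -}

module Defs where

open import Algebra.Bundles using (CommutativeMonoid; Ring)
open import Algebra.Module.Bundles using (LeftModule)
open import Algebra.Module.Morphism.Structures using (module LeftModuleMorphisms)
open import Data.Fin.Base as Fin using (Fin)
open import Data.Fin.Subset using (Subset; ⁅_⁆; ⋃; _∩_; ∣_∣; Nonempty)
import Data.Fin.Subset as Subset
open import Data.List.Base as List using (List; []; _∷_; _++_; [_])
open import Data.List.Relation.Unary.All using (All)
open import Data.List.Relation.Unary.Unique.Propositional using (Unique)
open import Data.Bool.Base using (if_then_else_)
open import Data.Nat.Base using (ℕ; zero; suc; _∸_; _≤_; parity)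
open import Data.Parity.Base as Parity using (Parity; 0ℙ; 1ℙ)
import Data.Parity.Properties as Parity
open import Data.Product.Base using (∃-syntax; Σ-syntax; _×_; _,_; proj₁; proj₂)
open import Data.Sum.Base using (_⊎_)
open import Data.Vec.Base as Vec using (Vec; replicate; zipWith; tabulate; _[_]≔_; []; _∷_)
open import Data.Vec.Properties using (zipWith-assoc; zipWith-comm; zipWith-identityˡ; zipWith-identityʳ; map-id; map-const)
open import Function.Base using (id; _∘_)
open import Function.Bundles using (_⇔_)
open import Function.Definitions using (Injective)
open import Level using (0ℓ)
open import Relation.Binary.Construct.Closure.ReflexiveTransitive using (Star; ε; _◅_)
open import Relation.Binary.Core using (Rel)
open import Relation.Binary.PropositionalEquality using (_≡_; _≢_; refl; sym; trans; cong; cong₂; subst; isEquivalence; module ≡-Reasoning)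

open import Relation.Unary using (Pred)

------------------------------------------------------------------------
-- Linear algebra over 𝔽₂

𝔽₂ : Ring 0ℓ 0ℓ
𝔽₂ = Parity.+-*-ring

Z₂^_ : ℕ → Set
Z₂^ n = Vec Parity n

private
  variable
    k k′ m n t : ℕ

infixl 6 _+ᵛ_
infixr 7 _*ᵛ_

_+ᵛ_ : Z₂^ n → Z₂^ n → Z₂^ n
_+ᵛ_ = zipWith Parity._+_

_*ᵛ_ : Parity → Z₂^ n → Z₂^ n
p *ᵛ x = Vec.map (p Parity.*_) x

0ᵛ : Z₂^ n
0ᵛ = replicate _ 0ℙ

unit : Fin n → Z₂^ n
unit i = 0ᵛ [ i ]≔ 1ℙ

private
  *ᵛ-distribˡ : ∀ p (x y : Z₂^ n) → p *ᵛ (x +ᵛ y) ≡ p *ᵛ x +ᵛ p *ᵛ y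
  *ᵛ-distribˡ p []      []      = refl
  *ᵛ-distribˡ p (a ∷ x) (b ∷ y) = cong₂ _∷_ (Parity.*-distribˡ-+ p a b) (*ᵛ-distribˡ p x y)

  *ᵛ-distribʳ : ∀ (x : Z₂^ n) p q → (p Parity.+ q) *ᵛ x ≡ p *ᵛ x +ᵛ q *ᵛ x
  *ᵛ-distribʳ []      p q = refl
  *ᵛ-distribʳ (a ∷ x) p q = cong₂ _∷_ (Parity.*-distribʳ-+ a p q) (*ᵛ-distribʳ x p q)

  *ᵛ-assoc : ∀ p q (x : Z₂^ n) → (p Parity.* q) *ᵛ x ≡ p *ᵛ (q *ᵛ x)
  *ᵛ-assoc p q []      = refl
  *ᵛ-assoc p q (a ∷ x) = cong₂ _∷_ (Parity.*-assoc p q a) (*ᵛ-assoc p q x)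

  *ᵛ-zeroʳ : ∀ p → p *ᵛ 0ᵛ {n} ≡ 0ᵛ
  *ᵛ-zeroʳ {n = zero}  p = refl
  *ᵛ-zeroʳ {n = suc n} p = cong₂ _∷_ (Parity.*-zeroʳ p) (*ᵛ-zeroʳ p)

  +ᵛ-self : ∀ (x : Z₂^ n) → x +ᵛ x ≡ 0ᵛ
  +ᵛ-self []       = refl
  +ᵛ-self (0ℙ ∷ x) = cong (0ℙ ∷_) (+ᵛ-self x)
  +ᵛ-self (1ℙ ∷ x) = cong (0ℙ ∷_) (+ᵛ-self x)

Z₂^-leftModule : ℕ → LeftModule 𝔽₂ 0ℓ 0ℓ
Z₂^-leftModule n = record
  { Carrierᴹ = Z₂^ n
  ; _≈ᴹ_ = _≡_
  ; _+ᴹ_ = _+ᵛ_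
  ; _*ₗ_ = _*ᵛ_
  ; 0ᴹ   = 0ᵛ
  ; -ᴹ_  = id
  ; isLeftModule = record
    { isLeftSemimodule = record
      { +ᴹ-isCommutativeMonoid = record
        { isMonoid = record
          { isSemigroup = record
            { isMagma = record { isEquivalence = isEquivalence ; ∙-cong = cong₂ _+ᵛ_ }
            ; assoc = zipWith-assoc Parity.+-assoc
            }
          ; identity = zipWith-identityˡ Parity.+-identityˡ , zipWith-identityʳ Parity.+-identityʳ
          }
        ; comm = zipWith-comm Parity.+-comm
        }
      ; isPreleftSemimodule = record
        { *ₗ-cong      = cong₂ _*ᵛ_
        ; *ₗ-zeroˡ     = λ x → map-const x 0ℙ
        ; *ₗ-distribʳ  = *ᵛ-distribʳ
        ; *ₗ-identityˡ = map-id
        ; *ₗ-assoc     = *ᵛ-assoc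
        ; *ₗ-zeroʳ     = *ᵛ-zeroʳ
        ; *ₗ-distribˡ  = *ᵛ-distribˡ
        }
      }
    ; -ᴹ‿cong    = id
    ; -ᴹ‿inverse = +ᵛ-self , +ᵛ-self
    }
  }

module _ {n : ℕ} where
  open LeftModule (Z₂^-leftModule n) using (+ᴹ-commutativeMonoid; *ₗ-distribʳ; *ₗ-distribˡ)
  open import Algebra.Properties.CommutativeMonoid.Sum +ᴹ-commutativeMonoid public
    using () renaming (sum to sumᵛ)
  open import Algebra.Properties.CommutativeMonoid.Sum +ᴹ-commutativeMonoid
    using (∑-distrib-+; sum-cong-≗)

  infix 4 _∈Span_

  combination : (Fin k → Parity) → (Fin k → Z₂^ n) → Z₂^ n
  combination a v = sumᵛ (λ i → a i *ᵛ v i)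

  _∈Span_ : Z₂^ n → (Fin k → Z₂^ n) → Set
  x ∈Span v = ∃[ a ] combination a v ≡ x

  LinearlyIndependent : (Fin k → Z₂^ n) → Set
  LinearlyIndependent v = ∀ a → combination a v ≡ 0ᵛ → ∀ i → a i ≡ 0ℙ

  record IsBasis (v : Fin k → Z₂^ n) (W : Pred (Z₂^ n) 0ℓ) : Set where
    field
      independent : LinearlyIndependent v
      spans       : ∀ x → W x ⇔ x ∈Span v

  HasDimension : Pred (Z₂^ n) 0ℓ → ℕ → Set
  HasDimension W d = ∃[ v ] IsBasis {d} v W

  -- A matrix is given by its rows.
  HasRank : (Fin k → Z₂^ n) → ℕ → Set
  HasRank A = HasDimension (_∈Span A)

  private
    ∈Span-+ : ∀ {x y} {v : Fin k → Z₂^ n} → x ∈Span v → y ∈Span v → (x +ᵛ y) ∈Span v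
    ∈Span-+ {v = v} (a , refl) (b , refl) = (λ i → a i Parity.+ b i) ,
      trans (sum-cong-≗ (λ i → *ₗ-distribʳ (v i) (a i) (b i)))
            (∑-distrib-+ (λ i → a i *ᵛ v i) (λ i → b i *ᵛ v i))

    sum-* : ∀ p (u : Fin k → Z₂^ n) → sumᵛ (λ i → p *ᵛ u i) ≡ p *ᵛ sumᵛ u
    sum-* {zero}  p u = sym (*ᵛ-zeroʳ p)
    sum-* {suc k} p u = trans (cong (p *ᵛ u Fin.zero +ᵛ_) (sum-* p (u ∘ Fin.suc)))
                              (sym (*ₗ-distribˡ p (u Fin.zero) (sumᵛ (u ∘ Fin.suc))))

    ∈Span-* : ∀ p {x} {v : Fin k → Z₂^ n} → x ∈Span v → (p *ᵛ x) ∈Span v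
    ∈Span-* p {v = v} (a , refl) = (λ i → p Parity.* a i) ,
      trans (sum-cong-≗ (λ i → *ᵛ-assoc p (a i) (v i))) (sum-* p (λ i → a i *ᵛ v i))

    ∈Span-0 : (v : Fin k → Z₂^ n) → 0ᵛ ∈Span v
    ∈Span-0 {zero}  v = (λ ()) , refl
    ∈Span-0 {suc k} v with ∈Span-0 (v ∘ Fin.suc)
    ... | a , eq = (λ { Fin.zero → 0ℙ ; (Fin.suc i) → a i }) ,
      trans (cong₂ _+ᵛ_ (map-const (v Fin.zero) 0ℙ) eq) (+ᵛ-self 0ᵛ)

  -- Z₂ⁿ / span A.  The quotient keeps the vectors of Z₂ⁿ as representatives
  -- and coarsens equality: x ≈ y iff x - y lies in the span.
  quotient : (Fin k → Z₂^ n) → LeftModule 𝔽₂ 0ℓ 0ℓ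
  quotient A = record
    { Carrierᴹ = Z₂^ n
    ; _≈ᴹ_ = _~_
    ; _+ᴹ_ = _+ᵛ_
    ; _*ₗ_ = _*ᵛ_
    ; 0ᴹ   = 0ᵛ
    ; -ᴹ_  = -ᴹ_
    ; isLeftModule = record
      { isLeftSemimodule = record
        { +ᴹ-isCommutativeMonoid = record
          { isMonoid = record
            { isSemigroup = record
              { isMagma = record
                { isEquivalence = record { refl = ≡⇒~ refl ; sym = ~-sym ; trans = ~-trans }
                ; ∙-cong = ~-cong
                }
              ; assoc = λ x y z → ≡⇒~ (+ᴹ-assoc x y z)
              }
            ; identity = (λ x → ≡⇒~ (+ᴹ-identityˡ x)) , (λ x → ≡⇒~ (+ᴹ-identityʳ x))
            }
          ; comm = λ x y → ≡⇒~ (+ᴹ-comm x y)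
          }
        ; isPreleftSemimodule = record
          { *ₗ-cong      = λ {p} → λ { refl x~y → *-cong p x~y }
          ; *ₗ-zeroˡ     = λ x → ≡⇒~ (*ₗ-zeroˡ x)
          ; *ₗ-distribʳ  = λ x p q → ≡⇒~ (*ₗ-distribʳ x p q)
          ; *ₗ-identityˡ = λ x → ≡⇒~ (*ₗ-identityˡ x)
          ; *ₗ-assoc     = λ p q x → ≡⇒~ (*ᵛ-assoc p q x)
          ; *ₗ-zeroʳ     = λ p → ≡⇒~ (*ᵛ-zeroʳ p)
          ; *ₗ-distribˡ  = λ p x y → ≡⇒~ (*ₗ-distribˡ p x y)
          }
        }
      ; -ᴹ‿cong    = id
      ; -ᴹ‿inverse = (λ x → ≡⇒~ (+ᵛ-self x)) , (λ x → ≡⇒~ (+ᵛ-self x))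
      }
    }
    where
    open LeftModule (Z₂^-leftModule n)
      using (-ᴹ_; +ᴹ-assoc; +ᴹ-comm; +ᴹ-identityˡ; +ᴹ-identityʳ; *ₗ-zeroˡ; *ₗ-identityˡ)
    open import Algebra.Properties.CommutativeSemigroup
      (CommutativeMonoid.commutativeSemigroup +ᴹ-commutativeMonoid)
      using (interchange)

    _~_ : Rel (Z₂^ n) 0ℓ
    x ~ y = (x +ᵛ (-ᴹ y)) ∈Span A

    ≡⇒~ : ∀ {x y} → x ≡ y → x ~ y
    ≡⇒~ {x} refl = subst (_∈Span A) (sym (+ᵛ-self x)) (∈Span-0 A)

    ~-sym : ∀ {x y} → x ~ y → y ~ x
    ~-sym {x} {y} = subst (_∈Span A) (+ᴹ-comm x y)

    ~-trans : ∀ {x y z} → x ~ y → y ~ z → x ~ z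
    ~-trans {x} {y} {z} p q = subst (_∈Span A) eq (∈Span-+ p q)
      where
      open ≡-Reasoning
      eq : (x +ᵛ y) +ᵛ (y +ᵛ z) ≡ x +ᵛ z
      eq = begin
        (x +ᵛ y) +ᵛ (y +ᵛ z) ≡⟨ cong (_+ᵛ (y +ᵛ z)) (+ᴹ-comm x y) ⟩
        (y +ᵛ x) +ᵛ (y +ᵛ z) ≡⟨ interchange y x y z ⟩
        (y +ᵛ y) +ᵛ (x +ᵛ z) ≡⟨ cong (_+ᵛ (x +ᵛ z)) (+ᵛ-self y) ⟩
        0ᵛ +ᵛ (x +ᵛ z)       ≡⟨ +ᴹ-identityˡ (x +ᵛ z) ⟩
        x +ᵛ z               ∎

    ~-cong : ∀ {x y u w} → x ~ y → u ~ w → (x +ᵛ u) ~ (y +ᵛ w)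
    ~-cong {x} {y} {u} {w} p q = subst (_∈Span A) (interchange x y u w) (∈Span-+ p q)

    *-cong : ∀ p {x y} → x ~ y → (p *ᵛ x) ~ (p *ᵛ y)
    *-cong p {x} {y} q = subst (_∈Span A) (*ₗ-distribˡ p x y) (∈Span-* p q)

  π : (A : Fin k → Z₂^ n) → Z₂^ n → LeftModule.Carrierᴹ (quotient A)
  π A x = x

IsLinearIsomorphism : (M N : LeftModule 𝔽₂ 0ℓ 0ℓ) → (LeftModule.Carrierᴹ M → LeftModule.Carrierᴹ N) → Set
IsLinearIsomorphism M N =
  LeftModuleMorphisms.IsLeftModuleIsomorphism (LeftModule.rawLeftModule M) (LeftModule.rawLeftModule N)

IsLinearMap : (Z₂^ k → Z₂^ k′) → Set
IsLinearMap {k} {k′} = LeftModuleMorphisms.IsLeftModuleHomomorphism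
  (LeftModule.rawLeftModule (Z₂^-leftModule k)) (LeftModule.rawLeftModule (Z₂^-leftModule k′))

sumList : List (Z₂^ n) → Z₂^ n
sumList = List.foldr _+ᵛ_ 0ᵛ

------------------------------------------------------------------------
-- Walks and distance in a graph given by an adjacency relation

module _ {V : Set} {R : Rel V 0ℓ} where

  walkLength : ∀ {x y} → Star R x y → ℕ
  walkLength ε       = 0
  walkLength (_ ◅ w) = suc (walkLength w)

  -- all vertices but the last
  sources : ∀ {x y} → Star R x y → List V
  sources         ε       = []
  sources {x = x} (_ ◅ w) = x ∷ sources w

  vertices : ∀ {x y} → Star R x y → List V
  vertices {y = y} w = sources w ++ [ y ]

record IsDistance {V : Set} (R : Rel V 0ℓ) (x y : V) (d : ℕ) : Set where
  field
    attained : ∃[ w ] walkLength {R = R} {x} {y} w ≡ d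
    minimal  : (w : Star R x y) → d ≤ walkLength w

-- f sends the vertex sequence of w to that of a walk along R′ with as many steps.
MapsToWalk : {V V′ : Set} {R : Rel V 0ℓ} (R′ : Rel V′ 0ℓ) (f : V → V′) {x y : V} → Star R x y → Set
MapsToWalk R′ f {x} {y} w = ∃[ w′ ]
  vertices {R = R′} {f x} {f y} w′ ≡ List.map f (vertices w) × walkLength w′ ≡ walkLength w

------------------------------------------------------------------------
-- Finite simple graphs

-- Vertices are Fin n and edges Fin m.  Listing the ends of each edge in
-- increasing order excludes loops and makes the pair of ends unordered, so
-- injectivity says that there are no parallel edges.
record Graph (n m : ℕ) : Set where
  field
    ends           : Fin m → Fin n × Fin n
    ends-ordered   : ∀ e → proj₁ (ends e) Fin.< proj₂ (ends e)
    ends-injective : Injective _≡_ _≡_ ends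

-- For a connected graph n ≤ m + 1, so the subtraction does not truncate.
cycleRank : (n m : ℕ) → ℕ
cycleRank n m = suc m ∸ n

module _ (G : Graph n m) where
  open Graph G

  Joins : Fin m → Rel (Fin n) 0ℓ
  Joins e u v = ends e ≡ (u , v) ⊎ ends e ≡ (v , u)

  Adjacent : Rel (Fin n) 0ℓ
  Adjacent u v = ∃[ e ] Joins e u v

  Walk : Rel (Fin n) 0ℓ
  Walk = Star Adjacent

  record Path (u v : Fin n) : Set where
    field
      walk     : Walk u v
      distinct : Unique (vertices walk)

  record Cycle : Set where
    field
      {base}   : Fin n
      walk     : Walk base base
      long     : 3 ≤ walkLength walk
      distinct : Unique (sources walk)

  Connected : Set
  Connected = ∀ u v → Path u v

  edges : ∀ {u v} → Walk u v → List (Fin m)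
  edges ε             = []
  edges ((e , _) ◅ w) = e ∷ edges w

  edgeSet : Cycle → Subset m
  edgeSet C = ⋃ (List.map ⁅_⁆ (edges (Cycle.walk C)))

indicator : Subset m → Z₂^ m
indicator = Vec.map (if_then 1ℙ else 0ℙ)

-- The subspace of the edge space generated by the edge sets of cycles.
CycleSpace : (G : Graph n m) → Pred (Z₂^ m) 0ℓ
CycleSpace G x = ∃[ l ] Σ[ C ∈ (Fin l → Cycle G) ] x ∈Span (λ i → indicator (edgeSet G (C i)))

IsCycleBasis : (G : Graph n m) → (Fin (cycleRank n m) → Cycle G) → Set
IsCycleBasis G B = IsBasis (λ i → indicator (edgeSet G (B i))) (CycleSpace G)

------------------------------------------------------------------------
-- Edge classes and assignments

record Partition (m t : ℕ) : Set where
  field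
    F        : Fin t → Subset m
    nonempty : ∀ j → Nonempty (F j)
    covers   : ∀ e → ∃[ j ] e Subset.∈ F j
    disjoint : ∀ {e i j} → e Subset.∈ F i → e Subset.∈ F j → i ≡ j

  class : Fin m → Fin t
  class e = proj₁ (covers e)

parityMatrix : (G : Graph n m) → Partition m t → (Fin k → Cycle G) → Fin k → Z₂^ t
parityMatrix G 𝒫 B i = tabulate λ j → parity ∣ Partition.F 𝒫 j ∩ edgeSet G (B i) ∣

module _ (G : Graph n m) (𝒫 : Partition m t) where
  open Partition 𝒫

  walkSum : (Fin t → Z₂^ k) → ∀ {u v} → Walk G u v → Z₂^ k
  walkSum g w = sumList (List.map (g ∘ class) (edges G w))

  Consistent : (Fin t → Z₂^ k) → Set
  Consistent g = (C : Cycle G) → walkSum g (Cycle.walk C) ≡ 0ᵛ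

  LinearImage : (g′ : Fin t → Z₂^ k′) (g : Fin t → Z₂^ k) → Set
  LinearImage g′ g = ∃[ T ] IsLinearMap T × (∀ j → g′ j ≡ T (g j))

  record MostGeneric (g : Fin t → Z₂^ k) : Set where
    field
      consistent : Consistent g
      universal  : ∀ {k′} (g′ : Fin t → Z₂^ k′) → Consistent g′ → LinearImage g′ g

  ConflictFree : Fin n → (Fin t → Z₂^ k) → Set
  ConflictFree r g = ∀ {v} (P Q : Path G r v) → walkSum g (Path.walk P) ≡ walkSum g (Path.walk Q)

  labeling : ∀ {r} → (∀ v → Path G r v) → (Fin t → Z₂^ k) → Fin n → Z₂^ k
  labeling P g v = walkSum g (Path.walk (P v))

  NonzeroLabels : (Fin t → Z₂^ k) → ∀ {u v} → Walk G u v → Set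
  NonzeroLabels g w = All (λ e → g (class e) ≢ 0ᵛ) (edges G w)

------------------------------------------------------------------------
-- Cayley graphs of Z₂ᵏ

nonzeroValues : (Fin t → Z₂^ k) → Pred (Z₂^ k) 0ℓ
nonzeroValues g s = s ≢ 0ᵛ × ∃[ j ] g j ≡ s

module _ {k : ℕ} (S : Pred (Z₂^ k) 0ℓ) where
  open LeftModule (Z₂^-leftModule k) using (-ᴹ_)

  record IsConnectionSet : Set where
    field
      nonzero    : ∀ {s} → S s → s ≢ 0ᵛ
      symmetric  : ∀ {s} → S s → S (-ᴹ s)
      generating : ∀ h → ∃[ ss ] All S ss × sumList ss ≡ h

  -- The edge {h , h + s}; the relation is symmetric because S = - S.
  CayleyAdjacent : Rel (Z₂^ k) 0ℓ
  CayleyAdjacent h h′ = ∃[ s ] S s × h′ ≡ h +ᵛ s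

{-# OPTIONS --safe #-}

-- Send each edge to the basis vector of its class.  This linear map takes the
-- edge set of a cycle to the vector of its class parities, so the class sums of
-- all cycles span exactly the rowspan of A; an assignment is consistent iff its
-- linear extension to Z₂ᵗ kills that span, and the quotient map is universal
-- among these.  Gaussian elimination on a basis of the rowspan computes the
-- quotient.  A closed walk that repeats no vertex is a cycle or goes back and
-- forth along one edge, and any other closed walk splits into shorter ones, so
-- consistency makes the sum along every closed walk vanish.  Hence λ changes by
-- g_class(e) along each edge e, and a geodesic of G becomes a walk in the Cayley
-- graph once its edges with zero label are contracted.
module Submission where

open import Defs
open import Algebra.Bundles using (CommutativeMonoid)
open import Algebra.Module.Bundles using (LeftModule)
open import Algebra.Module.Morphism.Structures using (module LeftModuleMorphisms)
open import Data.Bool.Base using (true; false; if_then_else_; _∧_)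
open import Data.Fin.Base as Fin using (Fin; zero; suc)
import Data.Fin.Properties as Fin
open import Data.Fin.Subset as Subset using (Subset; ⁅_⁆; ⋃; _∪_; _∩_; ∣_∣)
import Data.Fin.Subset.Properties as Subset
open import Data.List.Base as List using (List; []; _∷_; _++_)
import Data.List.Membership.DecPropositional as DecMembership
open import Data.List.Membership.Propositional using (_∈_; _∉_)
open import Data.List.Membership.Propositional.Properties using (∈-++⁺ʳ)
import Data.List.Properties as List
open import Data.List.Relation.Unary.All as All using (All; []; _∷_)
open import Data.List.Relation.Unary.All.Properties using (¬Any⇒All¬; All¬⇒¬Any)
open import Data.List.Relation.Unary.AllPairs as AllPairs using ([]; _∷_)
open import Data.List.Relation.Unary.Any using (here; there)
open import Data.List.Relation.Unary.Unique.Propositional using (Unique)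
import Data.List.Relation.Unary.Unique.Propositional.Properties as Unique
open import Data.Nat.Base using (ℕ; zero; suc; _+_; _∸_; _≤_; _<_; z≤n; s≤s; s≤s⁻¹; parity)
import Data.Nat.Properties as ℕ
open import Data.Parity.Base as Parity using (Parity; 0ℙ; 1ℙ)
import Data.Parity.Properties as Parity
open import Data.Product.Base using (∃-syntax; Σ-syntax; _×_; _,_; proj₁; proj₂)
open import Data.Product.Properties as Product using (,-injectiveˡ; ,-injectiveʳ)
open import Data.Sum.Base using (_⊎_; inj₁; inj₂; swap)
open import Data.Vec.Base as Vec using ([]; _∷_; lookup; tabulate; insertAt; removeAt)
import Data.Vec.Functional as Functional
open import Data.Vec.Properties as Vec
  using ( lookup-zipWith; lookup-map; lookup-replicate; lookup∘update; lookup∘update′; []=⇒lookup; lookup⇒[]=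
        ; insertAt-lookup; removeAt-insertAt; insertAt-removeAt; tabulate-cong; tabulate∘lookup; lookup∘tabulate)
open import Function.Base using (_∘_; id)
open import Function.Bundles using (Equivalence; mk⇔)
open import Level using (0ℓ)
open import Relation.Binary.Construct.Closure.Reflexive using (ReflClosure; [_]; refl; reflexive)
open import Relation.Binary.Construct.Closure.ReflexiveTransitive using (Star; ε; _◅_; _◅◅_; revApp)
open import Relation.Binary.Core using (Rel)
open import Relation.Binary.Definitions using (DecidableEquality)
open import Relation.Binary.PropositionalEquality
  using (_≡_; _≢_; refl; sym; trans; cong; cong₂; subst; subst₂; module ≡-Reasoning)
open import Relation.Nullary.Decidable using (Dec; yes; no; map′; _×-dec_; _⊎-dec_; ¬?)
open import Relation.Nullary.Negation.Core using (¬_; contradiction)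
open import Relation.Unary using (Pred; Decidable)

private
  variable
    k k′ l m n t ρ : ℕ

-- Linear algebra over 𝔽₂

module Z₂^ {n : ℕ} = LeftModule (Z₂^-leftModule n)
module Sumᵛ {n : ℕ} where
  open import Algebra.Properties.CommutativeMonoid.Sum (Z₂^.+ᴹ-commutativeMonoid {n}) public

open ≡-Reasoning

+ᵛ-cancelʳ : (x y : Z₂^ n) → (x +ᵛ y) +ᵛ y ≡ x
+ᵛ-cancelʳ x y = begin
  (x +ᵛ y) +ᵛ y  ≡⟨ Z₂^.+ᴹ-assoc x y y ⟩
  x +ᵛ (y +ᵛ y)  ≡⟨ cong (x +ᵛ_) (Z₂^.-ᴹ‿inverseʳ y) ⟩
  x +ᵛ 0ᵛ        ≡⟨ Z₂^.+ᴹ-identityʳ x ⟩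
  x              ∎

+ᵛ-moveʳ : {x y z : Z₂^ n} → x +ᵛ y ≡ z → x ≡ z +ᵛ y
+ᵛ-moveʳ {x = x} {y} refl = sym (+ᵛ-cancelʳ x y)

+ᵛ≡0⇒≡ : {x y : Z₂^ n} → x +ᵛ y ≡ 0ᵛ → x ≡ y
+ᵛ≡0⇒≡ {y = y} eq = trans (+ᵛ-moveʳ eq) (Z₂^.+ᴹ-identityˡ y)

-- The only scalars of 𝔽₂ are 0 and 1, so additivity already yields linearity and is the one
-- condition carried through the proofs.
Additive : (Z₂^ l → Z₂^ n) → Set
Additive f = ∀ x y → f (x +ᵛ y) ≡ f x +ᵛ f y

module _ {f : Z₂^ l → Z₂^ n} (f-+ : Additive f) where

  additive-0 : f 0ᵛ ≡ 0ᵛ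
  additive-0 = begin
    f 0ᵛ                   ≡⟨ +ᵛ-cancelʳ (f 0ᵛ) (f 0ᵛ) ⟨
    (f 0ᵛ +ᵛ f 0ᵛ) +ᵛ f 0ᵛ ≡⟨ cong (_+ᵛ f 0ᵛ) (f-+ 0ᵛ 0ᵛ) ⟨
    f (0ᵛ +ᵛ 0ᵛ) +ᵛ f 0ᵛ   ≡⟨ cong (λ x → f x +ᵛ f 0ᵛ) (Z₂^.+ᴹ-identityˡ 0ᵛ) ⟩
    f 0ᵛ +ᵛ f 0ᵛ           ≡⟨ Z₂^.-ᴹ‿inverseʳ (f 0ᵛ) ⟩
    0ᵛ                     ∎

  additive-* : ∀ p x → f (p *ᵛ x) ≡ p *ᵛ f x
  additive-* 0ℙ x = trans (cong f (Z₂^.*ₗ-zeroˡ x)) (trans additive-0 (sym (Z₂^.*ₗ-zeroˡ (f x))))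
  additive-* 1ℙ x = trans (cong f (Z₂^.*ₗ-identityˡ x)) (sym (Z₂^.*ₗ-identityˡ (f x)))

  additive-combination : (a : Fin k → Parity) (v : Fin k → Z₂^ l) →
                         f (combination a v) ≡ combination a (f ∘ v)
  additive-combination {zero}  a v = additive-0
  additive-combination {suc k} a v = trans (f-+ _ _)
    (cong₂ _+ᵛ_ (additive-* (a zero) (v zero)) (additive-combination (a ∘ suc) (v ∘ suc)))

  additive-sumList : {A : Set} (h : A → Z₂^ l) (xs : List A) →
                     f (sumList (List.map h xs)) ≡ sumList (List.map (f ∘ h) xs)
  additive-sumList h []       = additive-0
  additive-sumList h (x ∷ xs) = trans (f-+ _ _) (cong (f (h x) +ᵛ_) (additive-sumList h xs))

  additive-kills-span : ∀ {k} {v : Fin k → Z₂^ l} → (∀ i → f (v i) ≡ 0ᵛ) → ∀ {x} → x ∈Span v → f x ≡ 0ᵛ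
  additive-kills-span {k} {v = v} f-v (a , refl) = begin
    f (combination a v)            ≡⟨ additive-combination a v ⟩
    combination a (f ∘ v)          ≡⟨ Sumᵛ.sum-cong-≗ (λ i → trans (cong (a i *ᵛ_) (f-v i)) (Z₂^.*ₗ-zeroʳ (a i))) ⟩
    sumᵛ (Functional.replicate k 0ᵛ) ≡⟨ Sumᵛ.sum-replicate-zero k ⟩
    0ᵛ                             ∎

  additive⇒linear : IsLinearMap f
  additive⇒linear = record
    { +ᴹ-isGroupHomomorphism = record
      { isMonoidHomomorphism = record
        { isMagmaHomomorphism = record
          { isRelHomomorphism = record { cong = cong f }
          ; homo = f-+
          }
        ; ε-homo = additive-0
        }
      ; ⁻¹-homo = λ _ → refl
      }
    ; *ₗ-homo = additive-*
    }

extend : (Fin t → Z₂^ n) → Z₂^ t → Z₂^ n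
extend v x = combination (lookup x) v

extend-+ : (v : Fin t → Z₂^ n) → Additive (extend v)
extend-+ v x y = begin
  sumᵛ (λ i → lookup (x +ᵛ y) i *ᵛ v i)
    ≡⟨ Sumᵛ.sum-cong-≗ (λ i → cong (_*ᵛ v i) (lookup-zipWith Parity._+_ i x y)) ⟩
  sumᵛ (λ i → (lookup x i Parity.+ lookup y i) *ᵛ v i)
    ≡⟨ Sumᵛ.sum-cong-≗ (λ i → Z₂^.*ₗ-distribʳ (v i) (lookup x i) (lookup y i)) ⟩
  sumᵛ (λ i → lookup x i *ᵛ v i +ᵛ lookup y i *ᵛ v i)
    ≡⟨ Sumᵛ.∑-distrib-+ (λ i → lookup x i *ᵛ v i) (λ i → lookup y i *ᵛ v i) ⟩
  extend v x +ᵛ extend v y ∎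

extend-unit : (v : Fin t → Z₂^ n) (i : Fin t) → extend v (unit i) ≡ v i
extend-unit v zero = begin
  1ℙ *ᵛ v zero +ᵛ extend (v ∘ suc) 0ᵛ
    ≡⟨ cong₂ _+ᵛ_ (Z₂^.*ₗ-identityˡ (v zero)) (additive-0 (extend-+ (v ∘ suc))) ⟩
  v zero +ᵛ 0ᵛ  ≡⟨ Z₂^.+ᴹ-identityʳ (v zero) ⟩
  v zero        ∎
extend-unit v (suc i) = begin
  0ℙ *ᵛ v zero +ᵛ extend (v ∘ suc) (unit i)
    ≡⟨ cong₂ _+ᵛ_ (Z₂^.*ₗ-zeroˡ (v zero)) (extend-unit (v ∘ suc) i) ⟩
  0ᵛ +ᵛ v (suc i)  ≡⟨ Z₂^.+ᴹ-identityˡ (v (suc i)) ⟩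
  v (suc i)        ∎

combination-unit : (a : Fin t → Parity) → combination a unit ≡ tabulate a
combination-unit {zero}  a = refl
combination-unit {suc t} a = begin
  a zero *ᵛ unit zero +ᵛ combination (a ∘ suc) ((0ℙ ∷_) ∘ unit)
    ≡⟨ cong (a zero *ᵛ unit zero +ᵛ_) (additive-combination {f = 0ℙ ∷_} (λ _ _ → refl) (a ∘ suc) unit) ⟨
  (a zero Parity.* 1ℙ Parity.+ 0ℙ) ∷ (a zero *ᵛ 0ᵛ +ᵛ combination (a ∘ suc) unit)
    ≡⟨ cong₂ _∷_ (trans (Parity.+-identityʳ _) (Parity.*-identityʳ (a zero)))
         (trans (cong (_+ᵛ combination (a ∘ suc) unit) (Z₂^.*ₗ-zeroʳ (a zero))) (Z₂^.+ᴹ-identityˡ _)) ⟩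
  a zero ∷ combination (a ∘ suc) unit
    ≡⟨ cong (a zero ∷_) (combination-unit (a ∘ suc)) ⟩
  tabulate a ∎

combination-lookup-unit : (x : Z₂^ t) → combination (lookup x) unit ≡ x
combination-lookup-unit x = trans (combination-unit (lookup x)) (tabulate∘lookup x)

additive≗extend : {f : Z₂^ t → Z₂^ n} → Additive f → ∀ x → f x ≡ extend (f ∘ unit) x
additive≗extend {f = f} f-+ x =
  trans (cong f (sym (combination-lookup-unit x))) (additive-combination f-+ (lookup x) unit)

-- The span is the whole space, so the standard basis serves; none has to be extracted from `v`.
surjective⇒dimension : (v : Fin t → Z₂^ n) → (∀ y → ∃[ x ] extend v x ≡ y) → HasDimension (_∈Span v) n
surjective⇒dimension v surj = unit , record
  { independent = λ a eq i → begin
      a i                       ≡⟨ lookup∘tabulate a i ⟨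
      lookup (tabulate a) i     ≡⟨ cong (λ x → lookup x i) (trans (sym (combination-unit a)) eq) ⟩
      lookup 0ᵛ i               ≡⟨ lookup-replicate i 0ℙ ⟩
      0ℙ                        ∎
  ; spans = λ y → mk⇔ (λ _ → lookup y , combination-lookup-unit y)
                      (λ _ → let x , eq = surj y in lookup x , eq)
  }

removeAt-+ : (i : Fin (suc n)) → Additive (λ x → removeAt x i)
removeAt-+ zero    (_ ∷ _)         (_ ∷ _)         = refl
removeAt-+ (suc i) (a ∷ x@(_ ∷ _)) (b ∷ y@(_ ∷ _)) = cong (_ ∷_) (removeAt-+ i x y)

insertAt-0 : (i : Fin (suc n)) → insertAt 0ᵛ i 0ℙ ≡ 0ᵛ
insertAt-0         zero    = refl
insertAt-0 {suc n} (suc i) = cong (0ℙ ∷_) (insertAt-0 i)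

zero-or-pivot : (x : Z₂^ n) → x ≡ 0ᵛ ⊎ ∃[ i ] lookup x i ≡ 1ℙ
zero-or-pivot []       = inj₁ refl
zero-or-pivot (1ℙ ∷ x) = inj₂ (zero , refl)
zero-or-pivot (0ℙ ∷ x) with zero-or-pivot x
... | inj₁ refl     = inj₁ refl
... | inj₂ (i , eq) = inj₂ (suc i , eq)

-- One step of Gaussian elimination: clear the pivot coordinate by adding a
-- multiple of w, then drop it.  The kernel consists of the multiples of w.
module Elimination (w : Z₂^ (suc n)) (i : Fin (suc n)) (pivot : lookup w i ≡ 1ℙ) where

  clear : Z₂^ (suc n) → Z₂^ (suc n)
  clear x = x +ᵛ lookup x i *ᵛ w

  eliminate : Z₂^ (suc n) → Z₂^ n
  eliminate x = removeAt (clear x) i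

  clear-+ : Additive clear
  clear-+ x y = begin
    (x +ᵛ y) +ᵛ lookup (x +ᵛ y) i *ᵛ w
      ≡⟨ cong (λ p → (x +ᵛ y) +ᵛ p *ᵛ w) (lookup-zipWith Parity._+_ i x y) ⟩
    (x +ᵛ y) +ᵛ (lookup x i Parity.+ lookup y i) *ᵛ w
      ≡⟨ cong ((x +ᵛ y) +ᵛ_) (Z₂^.*ₗ-distribʳ w (lookup x i) (lookup y i)) ⟩
    (x +ᵛ y) +ᵛ (lookup x i *ᵛ w +ᵛ lookup y i *ᵛ w)
      ≡⟨ interchange x y _ _ ⟩
    clear x +ᵛ clear y ∎
    where
    open import Algebra.Properties.CommutativeSemigroup
      (CommutativeMonoid.commutativeSemigroup (Z₂^.+ᴹ-commutativeMonoid {suc n})) using (interchange)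

  eliminate-+ : Additive eliminate
  eliminate-+ x y = trans (cong (λ z → removeAt z i) (clear-+ x y)) (removeAt-+ i (clear x) (clear y))

  -- Parity's _+_ and _*_ have the same precedence.
  lookup-clear : ∀ x → lookup (clear x) i ≡ 0ℙ
  lookup-clear x = begin
    lookup (clear x) i                            ≡⟨ lookup-zipWith Parity._+_ i x _ ⟩
    lookup x i Parity.+ lookup (lookup x i *ᵛ w) i ≡⟨ cong (lookup x i Parity.+_) (lookup-map i _ w) ⟩
    lookup x i Parity.+ (lookup x i Parity.* lookup w i)
      ≡⟨ cong (λ p → lookup x i Parity.+ (lookup x i Parity.* p)) pivot ⟩
    lookup x i Parity.+ (lookup x i Parity.* 1ℙ)  ≡⟨ cong (lookup x i Parity.+_) (Parity.*-identityʳ _) ⟩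
    lookup x i Parity.+ lookup x i                ≡⟨ Parity.p+p≡0ℙ (lookup x i) ⟩
    0ℙ                                            ∎

  -- The coordinate dropped from `clear x` is 0, so dropping it loses nothing: if the rest vanishes
  -- too, `x` equals the multiple of `w` that was added.
  eliminate-kernel : ∀ x → eliminate x ≡ 0ᵛ → x ≡ lookup x i *ᵛ w
  eliminate-kernel x eq = +ᵛ≡0⇒≡ (begin
    clear x                                              ≡⟨ insertAt-removeAt (clear x) i ⟨
    insertAt (eliminate x) i (lookup (clear x) i)        ≡⟨ cong₂ (λ y p → insertAt y i p) eq (lookup-clear x) ⟩
    insertAt 0ᵛ i 0ℙ                                     ≡⟨ insertAt-0 i ⟩
    0ᵛ                                                   ∎)

  eliminate-w : eliminate w ≡ 0ᵛ
  eliminate-w = trans (cong (λ z → removeAt z i) clear-w) (additive-0 (removeAt-+ i))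
    where
    clear-w : clear w ≡ 0ᵛ
    clear-w = begin
      w +ᵛ lookup w i *ᵛ w ≡⟨ cong (λ p → w +ᵛ p *ᵛ w) pivot ⟩
      w +ᵛ 1ℙ *ᵛ w         ≡⟨ cong (w +ᵛ_) (Z₂^.*ₗ-identityˡ w) ⟩
      w +ᵛ w               ≡⟨ Z₂^.-ᴹ‿inverseʳ w ⟩
      0ᵛ                   ∎

  eliminate-surjective : ∀ y → ∃[ x ] eliminate x ≡ y
  eliminate-surjective y = x , trans (cong (λ z → removeAt z i) clear-x) (removeAt-insertAt y i 0ℙ)
    where
    x = insertAt y i 0ℙ
    clear-x : clear x ≡ x
    clear-x = begin
      x +ᵛ lookup x i *ᵛ w ≡⟨ cong (λ p → x +ᵛ p *ᵛ w) (insertAt-lookup y i 0ℙ) ⟩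
      x +ᵛ 0ℙ *ᵛ w         ≡⟨ cong (x +ᵛ_) (Z₂^.*ₗ-zeroˡ w) ⟩
      x +ᵛ 0ᵛ              ≡⟨ Z₂^.+ᴹ-identityʳ x ⟩
      x                    ∎

independent⇒nonzero : {v : Fin (suc k) → Z₂^ n} → LinearlyIndependent v → v zero ≢ 0ᵛ
independent⇒nonzero {v = v} indep v₀≡0 =
  contradiction (indep (lookup (unit zero)) (trans (extend-unit v zero) v₀≡0) zero) λ ()

-- A coordinate model of `Z₂^ t` modulo the span of `v`: `kills` and `kernel` together say that the
-- kernel of the surjection is exactly that span.
record Cokernel (v : Fin ρ → Z₂^ t) (d : ℕ) : Set where
  field
    map        : Z₂^ t → Z₂^ d
    map-+      : Additive map
    surjective : ∀ y → ∃[ x ] map x ≡ y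
    kills      : ∀ i → map (v i) ≡ 0ᵛ
    kernel     : ∀ x → map x ≡ 0ᵛ → x ∈Span v

-- Each elimination uses up one vector and one coordinate and keeps the images of the other vectors
-- independent. When no vector is left, the remaining `d` coordinates are the quotient.
independent⇒cokernel : (v : Fin ρ → Z₂^ t) → LinearlyIndependent v → ∃[ d ] ρ + d ≡ t × Cokernel v d
independent⇒cokernel {zero} {t} v _ = t , refl , record
  { map        = id
  ; map-+      = λ _ _ → refl
  ; surjective = λ y → y , refl
  ; kills      = λ ()
  ; kernel     = λ x x≡0 → (λ ()) , sym x≡0
  }
independent⇒cokernel {suc ρ} {t} v indep with zero-or-pivot (v zero)
... | inj₁ v₀≡0 = contradiction v₀≡0 (independent⇒nonzero {v = v} indep)
independent⇒cokernel {suc ρ} {suc t} v indep | inj₂ (i , pivot) =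
  let d , ρ+d≡t , C = independent⇒cokernel (eliminate ∘ v ∘ suc) indep′
      open Cokernel C
  in d , cong suc ρ+d≡t , record
  { map        = map ∘ eliminate
  ; map-+      = λ x y → trans (cong map (eliminate-+ x y)) (map-+ _ _)
  ; surjective = λ y → let x , x↦y = surjective y
                           x′ , x′↦x = eliminate-surjective x
                       in x′ , trans (cong map x′↦x) x↦y
  ; kills      = λ { zero → trans (cong map eliminate-w) (additive-0 map-+) ; (suc i) → kills i }
  ; kernel     = λ x x↦0 → lift-span x (kernel (eliminate x) x↦0)
  }
  where
  open Elimination (v zero) i pivot

  v′ = v ∘ suc

  indep′ : LinearlyIndependent (eliminate ∘ v′)
  indep′ a eq = indep (q Functional.∷ a) relation ∘ suc
    where
    -- The combination is eliminated to 0, so it is the multiple of `v zero` given by its pivot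
    -- entry; with this coefficient in front it becomes a relation among all of `v`.
    q = lookup (combination a v′) i
    relation : q *ᵛ v zero +ᵛ combination a v′ ≡ 0ᵛ
    relation = begin
      q *ᵛ v zero +ᵛ combination a v′  ≡⟨ cong (q *ᵛ v zero +ᵛ_)
        (eliminate-kernel _ (trans (additive-combination eliminate-+ a v′) eq)) ⟩
      q *ᵛ v zero +ᵛ q *ᵛ v zero       ≡⟨ Z₂^.-ᴹ‿inverseʳ (q *ᵛ v zero) ⟩
      0ᵛ                               ∎

  lift-span : ∀ x → eliminate x ∈Span (eliminate ∘ v′) → x ∈Span v
  lift-span x (a , eq) = q Functional.∷ a , sym (+ᵛ-moveʳ (eliminate-kernel y eliminate-y))
    where
    -- `x` and the lifted combination agree after elimination, so their sum is a multiple of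
    -- `v zero`.
    y = x +ᵛ combination a v′
    q = lookup y i
    eliminate-y : eliminate y ≡ 0ᵛ
    eliminate-y = begin
      eliminate y                                   ≡⟨ eliminate-+ x (combination a v′) ⟩
      eliminate x +ᵛ eliminate (combination a v′)   ≡⟨ cong (eliminate x +ᵛ_) (trans (additive-combination eliminate-+ a v′) eq) ⟩
      eliminate x +ᵛ eliminate x                    ≡⟨ Z₂^.-ᴹ‿inverseʳ (eliminate x) ⟩
      0ᵛ                                            ∎

cokernel⇒isomorphism : ∀ {d} {A : Fin k → Z₂^ t} {v : Fin ρ → Z₂^ t} → IsBasis v (_∈Span A) →
  (C : Cokernel v d) → IsLinearIsomorphism (quotient A) (Z₂^-leftModule d) (Cokernel.map C)
cokernel⇒isomorphism {A = A} {v} basis C = record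
  { isLeftModuleMonomorphism = record
    { isLeftModuleHomomorphism = record
      { +ᴹ-isGroupHomomorphism = record
        { isMonoidHomomorphism = record
          { isMagmaHomomorphism = record
            { isRelHomomorphism = record { cong = λ {x} {y} → map-cong {x} {y} }
            ; homo = map-+
            }
          ; ε-homo = additive-0 map-+
          }
        ; ⁻¹-homo = λ _ → refl
        }
      ; *ₗ-homo = additive-* map-+
      }
    -- Negation is the identity, so `x ≈ᴹ y` unfolds to `(x +ᵛ y) ∈Span A`; equal images put this
    -- sum into the kernel.
    ; injective = λ {x} {y} fx≡fy → Equivalence.from (spans (x +ᵛ y)) (kernel (x +ᵛ y) (begin
        map (x +ᵛ y)     ≡⟨ map-+ x y ⟩
        map x +ᵛ map y   ≡⟨ cong (map x +ᵛ_) fx≡fy ⟨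
        map x +ᵛ map x   ≡⟨ Z₂^.-ᴹ‿inverseʳ (map x) ⟩
        0ᵛ               ∎))
    }
  ; surjective = λ y → let x , x↦y = surjective y
                       in x , λ {z} z~x → trans (map-cong {z} {x} z~x) x↦y
  }
  where
  open Cokernel C
  open IsBasis basis
  open LeftModule (quotient A) using (_≈ᴹ_)

  map-cong : ∀ {x y} → x ≈ᴹ y → map x ≡ map y
  map-cong {x} {y} x~y = +ᵛ≡0⇒≡ (trans (sym (map-+ x y))
    (additive-kills-span map-+ kills (Equivalence.to (spans (x +ᵛ y)) x~y)))

-- The size of `p ∩ s` modulo 2 is the sum over `s` of the indicator of `p`, which coordinate `j` of
-- `h` reproduces. For `p = F j` and `h = unit ∘ class` this is an entry of the parity matrix.
parity-∩ : (p s : Subset n) (h : Fin n → Z₂^ t) (j : Fin t) →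
  (∀ e → lookup (h e) j ≡ lookup (indicator p) e) →
  parity ∣ p ∩ s ∣ ≡ lookup (extend h (indicator s)) j
parity-∩ []      []      h j eq = sym (lookup-replicate j 0ℙ)
parity-∩ (a ∷ p) (b ∷ s) h j eq = begin
  parity ∣ (a ∧ b) ∷ (p ∩ s) ∣
    ≡⟨ parity-∷ a b ⟩
  ((if b then 1ℙ else 0ℙ) Parity.* (if a then 1ℙ else 0ℙ)) Parity.+ parity ∣ p ∩ s ∣
    ≡⟨ cong₂ (λ x y → ((if b then 1ℙ else 0ℙ) Parity.* x) Parity.+ y)
         (sym (eq zero)) (parity-∩ p s (h ∘ suc) j (eq ∘ suc)) ⟩
  ((if b then 1ℙ else 0ℙ) Parity.* lookup (h zero) j) Parity.+ lookup (extend (h ∘ suc) (indicator s)) j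
    ≡⟨ cong (Parity._+ lookup (extend (h ∘ suc) (indicator s)) j) (lookup-map j _ (h zero)) ⟨
  lookup ((if b then 1ℙ else 0ℙ) *ᵛ h zero) j Parity.+ lookup (extend (h ∘ suc) (indicator s)) j
    ≡⟨ lookup-zipWith Parity._+_ j ((if b then 1ℙ else 0ℙ) *ᵛ h zero) _ ⟨
  lookup (extend h (indicator (b ∷ s))) j ∎
  where
  parity-∷ : ∀ a b → parity ∣ (a ∧ b) ∷ (p ∩ s) ∣ ≡
    ((if b then 1ℙ else 0ℙ) Parity.* (if a then 1ℙ else 0ℙ)) Parity.+ parity ∣ p ∩ s ∣
  parity-∷ false false = refl
  parity-∷ false true  = refl
  parity-∷ true  false = refl
  parity-∷ true  true  = trans (sym (Parity.⁻¹-involutive (parity (suc ∣ p ∩ s ∣))))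
                               (cong Parity._⁻¹ (Parity.suc-homo-⁻¹ ∣ p ∩ s ∣))

-- Walks and distances

least : {P : Pred ℕ 0ℓ} → Decidable P → P n → ∃[ d ] P d × (∀ {e} → P e → d ≤ e)
least {n = n} P? pn with P? 0
... | yes p0 = 0 , p0 , λ _ → z≤n
least {n = zero}  P? pn | no ¬p0 = contradiction pn ¬p0
least {n = suc n} P? pn | no ¬p0 =
  let d , pd , minimal = least (P? ∘ suc) pn
  in suc d , pd , λ { {zero} p0 → contradiction p0 ¬p0 ; {suc e} pe → s≤s (minimal pe) }

module _ {V : Set} {R : Rel V 0ℓ} where

  walkLength-◅◅ : ∀ {x y z} (w : Star R x y) (w′ : Star R y z) →
                  walkLength (w ◅◅ w′) ≡ walkLength w + walkLength w′
  walkLength-◅◅ ε       w′ = refl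
  walkLength-◅◅ (_ ◅ w) w′ = cong suc (walkLength-◅◅ w w′)

  start∈vertices : ∀ {x y} (w : Star R x y) → x ∈ vertices w
  start∈vertices ε       = here refl
  start∈vertices (_ ◅ _) = here refl

  finish∈vertices : ∀ {x y} (w : Star R x y) → y ∈ vertices w
  finish∈vertices w = ∈-++⁺ʳ (sources w) (here refl)

  closed-not-path : ∀ {x} (w : Star R x x) → 0 < walkLength w → ¬ Unique (vertices w)
  closed-not-path (_ ◅ w) _ (x∉w ∷ _) = All¬⇒¬Any x∉w (finish∈vertices w)

  -- Reflexive steps stand for edges with zero label. Deleting them never lengthens the walk, which
  -- is all that a distance bound needs.
  contract : ∀ {x y} (w : Star (ReflClosure R) x y) → ∃[ w′ ] walkLength {R = R} {x} {y} w′ ≤ walkLength w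
  contract ε            = ε , z≤n
  contract (refl ◅ w)   = let w′ , le = contract w in w′ , ℕ.m≤n⇒m≤1+n le
  contract ([ r ] ◅ w)  = let w′ , le = contract w in r ◅ w′ , s≤s le

  -- Both bounds serve an induction on length: a nonempty `after` makes `loop` shorter than `w`, and
  -- a nonempty `loop` makes `before ◅◅ after` shorter.
  record Detour {x y} (w : Star R x y) : Set where
    field
      {revisited}  : V
      before       : Star R x revisited
      loop         : Star R revisited revisited
      after        : Star R revisited y
      factors      : w ≡ before ◅◅ (loop ◅◅ after)
      loop-proper  : 0 < walkLength loop
      after-proper : 0 < walkLength after

  module _ (_≟_ : DecidableEquality V) where
    open DecMembership _≟_ using (_∈?_)

    split-at-source : ∀ {x y z} (w : Star R x y) → z ∈ sources w →
      Σ[ u ∈ Star R x z ] Σ[ v ∈ Star R z y ] w ≡ u ◅◅ v × 0 < walkLength v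
    split-at-source (r ◅ w) (here refl) = ε , r ◅ w , refl , s≤s z≤n
    split-at-source (r ◅ w) (there z∈w) =
      let u , v , w≡uv , 0<v = split-at-source w z∈w
      in r ◅ u , v , cong (r ◅_) w≡uv , 0<v

    -- Only sources are compared, since the last vertex of a closed walk always repeats the first. A
    -- source has a step after it, so a recurring one leaves `after` nonempty.
    unique-or-detour : ∀ {x y} (w : Star R x y) → Unique (sources w) ⊎ Detour w
    unique-or-detour ε = inj₁ []
    unique-or-detour {x} (r ◅ w) with x ∈? sources w
    ... | yes x∈w = let u , v , w≡uv , 0<v = split-at-source w x∈w in inj₂ record
      { before = ε ; loop = r ◅ u ; after = v
      ; factors = cong (r ◅_) w≡uv ; loop-proper = s≤s z≤n ; after-proper = 0<v }
    ... | no  x∉w with unique-or-detour w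
    ...   | inj₁ unique = inj₁ (¬Any⇒All¬ _ x∉w ∷ unique)
    ...   | inj₂ detour = inj₂ record
      { before = r ◅ before ; loop = loop ; after = after
      ; factors = cong (r ◅_) factors ; loop-proper = loop-proper ; after-proper = after-proper }
      where open Detour detour

    module _ (successor? : {P : Pred V 0ℓ} → Decidable P → ∀ x → Dec (∃[ y ] R x y × P y)) where

      -- Distances are found by searching over lengths. With `successor?` as a parameter, one search
      -- serves both `G` and the Cayley graph.
      walkOfLength? : ∀ d x y → Dec (∃[ w ] walkLength {R = R} {x} {y} w ≡ d)
      walkOfLength? zero    x y = map′ (λ { refl → ε , refl }) (λ { (ε , _) → refl }) (x ≟ y)
      walkOfLength? (suc d) x y =
        map′ (λ { (_ , r , w , eq) → r ◅ w , cong suc eq })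
             (λ { (r ◅ w , eq) → _ , r , w , ℕ.suc-injective eq })
             (successor? (λ z → walkOfLength? d z y) x)

      distance : ∀ {x y} → Star R x y → ∃[ d ] IsDistance R x y d
      distance {x} {y} w =
        let d , attained , minimal = least (λ d → walkOfLength? d x y) (w , refl)
        in d , record { attained = attained ; minimal = λ w′ → minimal (w′ , refl) }

-- Indicator vectors

lookup-indicator-∈ : ∀ {p : Subset n} {e} → e Subset.∈ p → lookup (indicator p) e ≡ 1ℙ
lookup-indicator-∈ {p = p} {e} e∈p = trans (lookup-map e _ p) (cong (if_then 1ℙ else 0ℙ) ([]=⇒lookup e∈p))

lookup-indicator-∉ : ∀ {p : Subset n} {e} → e Subset.∉ p → lookup (indicator p) e ≡ 0ℙ
lookup-indicator-∉ {p = p} {e} e∉p with lookup p e in eq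
... | true  = contradiction (lookup⇒[]= e p eq) e∉p
... | false = trans (lookup-map e _ p) (cong (if_then 1ℙ else 0ℙ) eq)

indicator-⊥ : indicator (Subset.⊥ {n}) ≡ 0ᵛ
indicator-⊥ = Vec.map-replicate _ _ _

indicator-⁅e⁆∪ : ∀ (e : Fin n) (s : Subset n) → e Subset.∉ s → indicator (⁅ e ⁆ ∪ s) ≡ unit e +ᵛ indicator s
indicator-⁅e⁆∪ zero    (true  ∷ s) e∉s = contradiction Vec.here e∉s
indicator-⁅e⁆∪ zero    (false ∷ s) e∉s = cong (1ℙ ∷_)
  (trans (cong indicator (Subset.∪-identityˡ s)) (sym (Z₂^.+ᴹ-identityˡ (indicator s))))
indicator-⁅e⁆∪ (suc e) (b ∷ s)     e∉s = cong (_ ∷_) (indicator-⁅e⁆∪ e s (e∉s ∘ Vec.there))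

∈⋃⇒∈ : ∀ {e : Fin n} es → e Subset.∈ ⋃ (List.map ⁅_⁆ es) → e ∈ es
∈⋃⇒∈ []        e∈ = contradiction e∈ Subset.∉⊥
∈⋃⇒∈ (e′ ∷ es) e∈ with Subset.x∈p∪q⁻ ⁅ e′ ⁆ _ e∈
... | inj₁ e∈e′ = here (Subset.x∈⁅y⁆⇒x≡y e′ e∈e′)
... | inj₂ e∈es = there (∈⋃⇒∈ es e∈es)

-- Distinctness matters: an edge listed twice would stay in the union but cancel in the sum over 𝔽₂.
indicator-⋃ : {es : List (Fin n)} → Unique es → indicator (⋃ (List.map ⁅_⁆ es)) ≡ sumList (List.map unit es)
indicator-⋃ []                    = indicator-⊥
indicator-⋃ {es = e ∷ es} (e∉es ∷ unique) =
  trans (indicator-⁅e⁆∪ e _ (All¬⇒¬Any e∉es ∘ ∈⋃⇒∈ es)) (cong (unit e +ᵛ_) (indicator-⋃ unique))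

module _ (𝒫 : Partition m t) where
  open Partition 𝒫

  lookup-unit-class : ∀ j e → lookup (unit (class e)) j ≡ lookup (indicator (F j)) e
  lookup-unit-class j e with class e Fin.≟ j
  ... | yes refl = trans (lookup∘update (class e) 0ᵛ 1ℙ) (sym (lookup-indicator-∈ (proj₂ (covers e))))
  ... | no  c≢j  = trans (lookup∘update′ (c≢j ∘ sym) 0ᵛ 1ℙ) (trans (lookup-replicate j 0ℙ)
                     (sym (lookup-indicator-∉ λ e∈Fj → c≢j (disjoint (proj₂ (covers e)) e∈Fj))))

-- Cayley graphs

_≟ᵛ_ : DecidableEquality (Z₂^ n)
_≟ᵛ_ = Vec.≡-dec Parity._≟_

module _ (g : Fin t → Z₂^ k) where

  -- The neighbours of `x` are the `x +ᵛ g j` with `g j` nonzero, so trying the `t` indices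
  -- suffices.
  cayley-successor? : {P : Pred (Z₂^ k) 0ℓ} → Decidable P → ∀ x →
    Dec (∃[ y ] CayleyAdjacent (nonzeroValues g) x y × P y)
  cayley-successor? {P} P? x =
    map′ (λ { (j , gj≢0 , py) → _ , (g j , (gj≢0 , j , refl) , refl) , py })
         (λ { (_ , (_ , (gj≢0 , j , refl) , refl) , py) → j , gj≢0 , py })
         (Fin.any? λ j → ¬? (g j ≟ᵛ 0ᵛ) ×-dec P? (x +ᵛ g j))

nonzeroValues-suc : {g : Fin (suc t) → Z₂^ k} → ∀ {s} → nonzeroValues (g ∘ suc) s → nonzeroValues g s
nonzeroValues-suc (s≢0 , j , gj≡s) = s≢0 , suc j , gj≡s

-- Terms with zero coefficient or zero value contribute nothing; the others are nonzero values with
-- coefficient 1.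
nonzeroSummands : (a : Fin t → Parity) (g : Fin t → Z₂^ k) →
  ∃[ ss ] All (nonzeroValues g) ss × sumList ss ≡ combination a g
nonzeroSummands {zero}  a g = [] , [] , refl
nonzeroSummands {suc t} a g with nonzeroSummands (a ∘ suc) (g ∘ suc) | a zero | g zero ≟ᵛ 0ᵛ
... | ss , nz , eq | 0ℙ | _ = ss , All.map nonzeroValues-suc nz ,
  trans eq (sym (trans (cong (_+ᵛ combination (a ∘ suc) (g ∘ suc)) (Z₂^.*ₗ-zeroˡ (g zero))) (Z₂^.+ᴹ-identityˡ _)))
... | ss , nz , eq | 1ℙ | yes g₀≡0 = ss , All.map nonzeroValues-suc nz ,
  trans eq (sym (trans (cong (_+ᵛ combination (a ∘ suc) (g ∘ suc)) (trans (Z₂^.*ₗ-identityˡ (g zero)) g₀≡0)) (Z₂^.+ᴹ-identityˡ _)))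
... | ss , nz , eq | 1ℙ | no g₀≢0 = g zero ∷ ss ,
  (g₀≢0 , zero , refl) ∷ All.map nonzeroValues-suc nz ,
  cong₂ _+ᵛ_ (sym (Z₂^.*ₗ-identityˡ (g zero))) eq

nonzeroValues-isConnectionSet : (g : Fin t → Z₂^ k) → (∀ y → ∃[ x ] extend g x ≡ y) →
  IsConnectionSet (nonzeroValues g)
nonzeroValues-isConnectionSet g generated = record
  { nonzero    = proj₁
  -- In characteristic 2 every element is its own negative.
  ; symmetric  = id
  ; generating = λ h → let x , x↦h = generated h
                           ss , nz , eq = nonzeroSummands (lookup x) g
                       in ss , nz , trans eq x↦h
  }

-- Cycles and walk sums

-- When the first step of a cycle based at `x` is removed, `xs ++ List.[ x ]` is the vertex list of
-- what remains.
unique-rotate : ∀ {A : Set} {x : A} (xs : List A) → Unique (x ∷ xs) → Unique (xs ++ List.[ x ])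
unique-rotate xs (x∉xs ∷ unique) =
  Unique.++⁺ unique ([] ∷ []) λ { (x∈xs , here refl) → All¬⇒¬Any x∉xs x∈xs }

module _ (G : Graph n m) where
  open Graph G

  increasing : ∀ {e u v} → ends e ≡ (u , v) → u Fin.< v
  increasing {e} p = subst₂ Fin._<_ (cong proj₁ p) (cong proj₂ p) (ends-ordered e)

  joins-irrefl : ∀ {e u} → ¬ Joins G e u u
  joins-irrefl (inj₁ p) = Fin.<-irrefl refl (increasing p)
  joins-irrefl (inj₂ p) = Fin.<-irrefl refl (increasing p)

  -- This forces a closed walk of length 2 to use one edge twice. Ends stored in the same order are
  -- identified by injectivity; opposite orders would give both `u < v` and `v < u`.
  same-ends : ∀ {e f u v} → Joins G e u v → Joins G f v u → e ≡ f
  same-ends (inj₁ p) (inj₂ q) = ends-injective (trans p (sym q))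
  same-ends (inj₂ p) (inj₁ q) = ends-injective (trans p (sym q))
  same-ends (inj₁ p) (inj₁ q) = contradiction (increasing q) (Fin.<-asym (increasing p))
  same-ends (inj₂ p) (inj₂ q) = contradiction (increasing q) (Fin.<-asym (increasing p))

  other-end : ∀ {e u v x y} → Joins G e u v → Joins G e x y → u ≡ x ⊎ u ≡ y
  other-end (inj₁ p) (inj₁ q) = inj₁ (,-injectiveˡ (trans (sym p) q))
  other-end (inj₁ p) (inj₂ q) = inj₂ (,-injectiveˡ (trans (sym p) q))
  other-end (inj₂ p) (inj₁ q) = inj₂ (,-injectiveʳ (trans (sym p) q))
  other-end (inj₂ p) (inj₂ q) = inj₁ (,-injectiveʳ (trans (sym p) q))

  end∈vertices : ∀ {e u v x y} (w : Walk G x y) → Joins G e u v → e ∈ edges G w → u ∈ vertices w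
  end∈vertices ((e , j) ◅ w) i (here refl) with other-end i j
  ... | inj₁ refl = here refl
  ... | inj₂ refl = there (start∈vertices w)
  end∈vertices (_ ◅ w) i (there e∈w) = there (end∈vertices w i e∈w)

  -- If the first edge occurred again, its starting vertex would reappear later on the walk.
  path-edges-unique : ∀ {x y} (w : Walk G x y) → Unique (vertices w) → Unique (edges G w)
  path-edges-unique ε             _                = []
  path-edges-unique ((e , j) ◅ w) (x∉w ∷ unique) =
    ¬Any⇒All¬ _ (All¬⇒¬Any x∉w ∘ end∈vertices w j) ∷ path-edges-unique w unique

  -- A cycle without its first edge e is a path; e could only recur as the first
  -- edge of that path, which would then have length 1.
  cycle-edges-unique : (C : Cycle G) → Unique (edges G (Cycle.walk C))
  cycle-edges-unique C with Cycle.walk C | Cycle.long C | Cycle.distinct C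
  ... | (e , j) ◅ (f , i) ◅ w | s≤s (s≤s 1≤w) | distinct =
    ¬Any⇒All¬ _ e∉ ∷ path-edges-unique ((f , i) ◅ w) path
    where
    path : Unique (vertices ((f , i) ◅ w))
    path = unique-rotate _ distinct

    e∉ : e ∉ edges G ((f , i) ◅ w)
    e∉ (here refl) with other-end j (swap i)
    ... | inj₂ refl = joins-irrefl j
    ... | inj₁ refl = closed-not-path w 1≤w (AllPairs.tail path)
    e∉ (there e∈w) = All¬⇒¬Any (AllPairs.head path) (end∈vertices w (swap j) e∈w)

  adjacent-sym : ∀ {u v} → Adjacent G u v → Adjacent G v u
  adjacent-sym (e , j) = e , swap j

  successor? : {P : Pred (Fin n) 0ℓ} → Decidable P → ∀ u → Dec (∃[ v ] Adjacent G u v × P v)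
  successor? P? u = Fin.any? λ v →
    Fin.any? (λ e → ends e ≟ (u , v) ⊎-dec ends e ≟ (v , u)) ×-dec P? v
    where _≟_ = Product.≡-dec Fin._≟_ Fin._≟_

-- Class vectors of cycles and the row span

module _ (G : Graph n m) (𝒫 : Partition m t) where
  open Partition 𝒫

  classVector : Z₂^ m → Z₂^ t
  classVector = extend (unit ∘ class)

  -- The cycle space sees a cycle as an edge set, consistency sees it as a list of edges. The two
  -- agree modulo 2 because a cycle repeats no edge.
  classVector-cycle : (C : Cycle G) →
    classVector (indicator (edgeSet G C)) ≡ walkSum G 𝒫 unit (Cycle.walk C)
  classVector-cycle C = begin
    classVector (indicator (edgeSet G C))
      ≡⟨ cong classVector (indicator-⋃ (cycle-edges-unique G C)) ⟩
    classVector (sumList (List.map unit es))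
      ≡⟨ additive-sumList (extend-+ (unit ∘ class)) unit es ⟩
    sumList (List.map (classVector ∘ unit) es)
      ≡⟨ cong sumList (List.map-cong (extend-unit (unit ∘ class)) es) ⟩
    walkSum G 𝒫 unit (Cycle.walk C) ∎
    where es = edges G (Cycle.walk C)

  parityMatrix-row : (B : Fin k → Cycle G) (i : Fin k) →
    parityMatrix G 𝒫 B i ≡ walkSum G 𝒫 unit (Cycle.walk (B i))
  parityMatrix-row B i = begin
    parityMatrix G 𝒫 B i
      ≡⟨ tabulate-cong (λ j → parity-∩ (F j) s (unit ∘ class) j (lookup-unit-class 𝒫 j)) ⟩
    tabulate (lookup (classVector (indicator s)))
      ≡⟨ tabulate∘lookup _ ⟩
    classVector (indicator s)
      ≡⟨ classVector-cycle (B i) ⟩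
    walkSum G 𝒫 unit (Cycle.walk (B i)) ∎
    where s = edgeSet G (B i)

  -- Applying `classVector` to the expansion of `C` in the cycle basis turns the basis cycles into
  -- rows and keeps the coefficients.
  cycle∈rowspan : (B : Fin (cycleRank n m) → Cycle G) → IsCycleBasis G B → (C : Cycle G) →
    walkSum G 𝒫 unit (Cycle.walk C) ∈Span parityMatrix G 𝒫 B
  cycle∈rowspan B basis C =
    let a , eq = Equivalence.to (IsBasis.spans basis c) c∈cycleSpace
    in a , (begin
      combination a (parityMatrix G 𝒫 B)
        ≡⟨ Sumᵛ.sum-cong-≗ (λ i → cong (a i *ᵛ_) (trans (parityMatrix-row B i) (sym (classVector-cycle (B i))))) ⟩
      combination a (λ i → classVector (indicator (edgeSet G (B i))))
        ≡⟨ additive-combination (extend-+ (unit ∘ class)) a (λ i → indicator (edgeSet G (B i))) ⟨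
      classVector (combination a (λ i → indicator (edgeSet G (B i))))
        ≡⟨ cong classVector eq ⟩
      classVector c
        ≡⟨ classVector-cycle C ⟩
      walkSum G 𝒫 unit (Cycle.walk C) ∎)
    where
    c = indicator (edgeSet G C)
    c∈cycleSpace : CycleSpace G c
    -- A combination of one term; its coefficient 1 is written as a unit vector so that
    -- `extend-unit` evaluates it.
    c∈cycleSpace = 1 , (λ _ → C) , lookup (unit zero) , extend-unit {t = 1} (λ _ → c) zero

  additive-walkSum : {f : Z₂^ k → Z₂^ k′} → Additive f → (g : Fin t → Z₂^ k) →
    ∀ {u v} (w : Walk G u v) → f (walkSum G 𝒫 g w) ≡ walkSum G 𝒫 (f ∘ g) w
  additive-walkSum f-+ g w = additive-sumList f-+ (g ∘ class) (edges G w)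

  -- A row is the formal sum of the classes along `B i`, and `extend g` evaluates this formal sum at
  -- `g`.
  consistent⇒kills-rows : {g : Fin t → Z₂^ k} → Consistent G 𝒫 g →
    (B : Fin l → Cycle G) → ∀ i → extend g (parityMatrix G 𝒫 B i) ≡ 0ᵛ
  consistent⇒kills-rows {g = g} consistent B i = begin
    extend g (parityMatrix G 𝒫 B i)
      ≡⟨ cong (extend g) (parityMatrix-row B i) ⟩
    extend g (walkSum G 𝒫 unit (Cycle.walk (B i)))
      ≡⟨ additive-sumList (extend-+ g) (unit ∘ class) es ⟩
    sumList (List.map (extend g ∘ unit ∘ class) es)
      ≡⟨ cong sumList (List.map-cong (extend-unit g ∘ class) es) ⟩
    walkSum G 𝒫 g (Cycle.walk (B i))
      ≡⟨ consistent (B i) ⟩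
    0ᵛ ∎
    where es = edges G (Cycle.walk (B i))

  -- Sums along walks and the labeling

  module _ (g : Fin t → Z₂^ k) where

    walkSum-◅◅ : ∀ {u v x} (w : Walk G u v) (w′ : Walk G v x) →
      walkSum G 𝒫 g (w ◅◅ w′) ≡ walkSum G 𝒫 g w +ᵛ walkSum G 𝒫 g w′
    walkSum-◅◅ ε             w′ = sym (Z₂^.+ᴹ-identityˡ _)
    walkSum-◅◅ ((e , _) ◅ w) w′ =
      trans (cong (g (class e) +ᵛ_) (walkSum-◅◅ w w′)) (sym (Z₂^.+ᴹ-assoc _ _ _))

    -- An edge has the same label in both directions and addition commutes, so reversal keeps the
    -- sum.
    walkSum-revApp : ∀ {u v x} (w : Walk G v u) (w′ : Walk G v x) →
      walkSum G 𝒫 g (revApp (adjacent-sym G) w w′) ≡ walkSum G 𝒫 g w +ᵛ walkSum G 𝒫 g w′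
    walkSum-revApp ε             w′ = sym (Z₂^.+ᴹ-identityˡ _)
    walkSum-revApp ((e , j) ◅ w) w′ = begin
      walkSum G 𝒫 g (revApp (adjacent-sym G) w ((e , swap j) ◅ w′))
        ≡⟨ walkSum-revApp w _ ⟩
      walkSum G 𝒫 g w +ᵛ (g (class e) +ᵛ walkSum G 𝒫 g w′)
        ≡⟨ Z₂^.+ᴹ-assoc _ _ _ ⟨
      (walkSum G 𝒫 g w +ᵛ g (class e)) +ᵛ walkSum G 𝒫 g w′
        ≡⟨ cong (_+ᵛ walkSum G 𝒫 g w′) (Z₂^.+ᴹ-comm _ _) ⟩
      (g (class e) +ᵛ walkSum G 𝒫 g w) +ᵛ walkSum G 𝒫 g w′ ∎

    module _ (consistent : Consistent G 𝒫 g) where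

      -- The induction runs on a bound `d` for the length, because the loop and the walk without it
      -- are not subterms of `w`.
      closed-walkSum : ∀ d {u} (w : Walk G u u) → walkLength w ≤ d → walkSum G 𝒫 g w ≡ 0ᵛ
      closed-walkSum d       ε _ = refl
      closed-walkSum (suc d) w@((e , j) ◅ w₁) (s≤s len≤d) with unique-or-detour Fin._≟_ w
      ... | inj₂ detour = begin
        walkSum G 𝒫 g w
          ≡⟨ cong (walkSum G 𝒫 g) factors ⟩
        walkSum G 𝒫 g (before ◅◅ (loop ◅◅ after))
          ≡⟨ trans (walkSum-◅◅ before _) (cong (walkSum G 𝒫 g before +ᵛ_) (walkSum-◅◅ loop after)) ⟩
        walkSum G 𝒫 g before +ᵛ (walkSum G 𝒫 g loop +ᵛ walkSum G 𝒫 g after)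
          ≡⟨ cong (λ x → walkSum G 𝒫 g before +ᵛ (x +ᵛ walkSum G 𝒫 g after)) (closed-walkSum d loop loop≤d) ⟩
        walkSum G 𝒫 g before +ᵛ (0ᵛ +ᵛ walkSum G 𝒫 g after)
          ≡⟨ cong (walkSum G 𝒫 g before +ᵛ_) (Z₂^.+ᴹ-identityˡ _) ⟩
        walkSum G 𝒫 g before +ᵛ walkSum G 𝒫 g after
          ≡⟨ walkSum-◅◅ before after ⟨
        walkSum G 𝒫 g (before ◅◅ after)
          ≡⟨ closed-walkSum d (before ◅◅ after) shortcut≤d ⟩
        0ᵛ ∎
        where
        open Detour detour
        b = walkLength before
        ℓ = walkLength loop
        a = walkLength after

        lengths : suc (walkLength w₁) ≡ b + (ℓ + a)
        lengths = trans (cong walkLength factors)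
          (trans (walkLength-◅◅ before _) (cong (b +_) (walkLength-◅◅ loop after)))

        loop≤d : ℓ ≤ d
        loop≤d = s≤s⁻¹ (ℕ.<-≤-trans
          (ℕ.<-≤-trans (ℕ.m<m+n ℓ after-proper) (ℕ.m≤n+m (ℓ + a) b))
          (ℕ.≤-trans (ℕ.≤-reflexive (sym lengths)) (s≤s len≤d)))

        shortcut≤d : walkLength (before ◅◅ after) ≤ d
        shortcut≤d = s≤s⁻¹ (ℕ.≤-<-trans (ℕ.≤-reflexive (walkLength-◅◅ before after))
          (ℕ.<-≤-trans (ℕ.+-monoʳ-< b (ℕ.m<n+m a loop-proper))
          (ℕ.≤-trans (ℕ.≤-reflexive (sym lengths)) (s≤s len≤d))))
      ... | inj₁ unique with w₁
      -- Length 1 would be a loop, and length 2 returns along the same edge, whose label cancels.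
      -- From length 3 on, distinct sources make the walk a `Cycle`.
      ...   | ε = contradiction j (joins-irrefl G)
      ...   | (f , i) ◅ ε = begin
        g (class e) +ᵛ (g (class f) +ᵛ 0ᵛ) ≡⟨ cong (g (class e) +ᵛ_) (Z₂^.+ᴹ-identityʳ _) ⟩
        g (class e) +ᵛ g (class f)         ≡⟨ cong (λ e → g (class e) +ᵛ g (class f)) (same-ends G j i) ⟩
        g (class f) +ᵛ g (class f)         ≡⟨ Z₂^.-ᴹ‿inverseʳ _ ⟩
        0ᵛ                                 ∎
      ...   | step₂ ◅ step₃ ◅ w₃ = consistent record
        { walk = (e , j) ◅ step₂ ◅ step₃ ◅ w₃ ; long = s≤s (s≤s (s≤s z≤n)) ; distinct = unique }

      -- `w` reversed and followed by `w′` is a closed walk at `v`, and a vanishing sum of two terms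
      -- means equality in characteristic 2.
      walkSum-unique : ∀ {u v} (w w′ : Walk G u v) → walkSum G 𝒫 g w ≡ walkSum G 𝒫 g w′
      walkSum-unique w w′ = +ᵛ≡0⇒≡ (trans (sym (walkSum-revApp w w′)) (closed-walkSum _ (revApp (adjacent-sym G) w w′) ℕ.≤-refl))

      module _ {r : Fin n} (P : ∀ v → Path G r v) where

        -- The chosen path to `u` extended by `e` competes with the chosen path to `v`. The
        -- extension may revisit a vertex, so independence is needed for walks and not only for
        -- paths.
        label-edge : ∀ {e u v} → Joins G e u v →
          labeling G 𝒫 P g v ≡ labeling G 𝒫 P g u +ᵛ g (class e)
        label-edge {e} {u} {v} j = begin
          walkSum G 𝒫 g (Path.walk (P v))
            ≡⟨ walkSum-unique (Path.walk (P v)) (Path.walk (P u) ◅◅ (e , j) ◅ ε) ⟩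
          walkSum G 𝒫 g (Path.walk (P u) ◅◅ (e , j) ◅ ε)
            ≡⟨ walkSum-◅◅ (Path.walk (P u)) ((e , j) ◅ ε) ⟩
          walkSum G 𝒫 g (Path.walk (P u)) +ᵛ (g (class e) +ᵛ 0ᵛ)
            ≡⟨ cong (walkSum G 𝒫 g (Path.walk (P u)) +ᵛ_) (Z₂^.+ᴹ-identityʳ _) ⟩
          walkSum G 𝒫 g (Path.walk (P u)) +ᵛ g (class e) ∎

        label-step : ∀ {e u v} → Joins G e u v → g (class e) ≢ 0ᵛ →
          CayleyAdjacent (nonzeroValues g) (labeling G 𝒫 P g u) (labeling G 𝒫 P g v)
        label-step j g≢0 = _ , (g≢0 , _ , refl) , label-edge j

        -- Zero is not a generator, so an edge with zero label yields no Cayley edge; its two ends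
        -- then share one label.
        label-reflStep : ∀ {e u v} → Joins G e u v →
          ReflClosure (CayleyAdjacent (nonzeroValues g)) (labeling G 𝒫 P g u) (labeling G 𝒫 P g v)
        label-reflStep {e} j with g (class e) ≟ᵛ 0ᵛ
        ... | no  g≢0 = [ label-step j g≢0 ]
        ... | yes g≡0 = reflexive (sym
          (trans (label-edge j) (trans (cong (labeling G 𝒫 P g _ +ᵛ_) g≡0) (Z₂^.+ᴹ-identityʳ _))))

        label-walk : ∀ {u v} (w : Walk G u v) → NonzeroLabels G 𝒫 g w →
          MapsToWalk (CayleyAdjacent (nonzeroValues g)) (labeling G 𝒫 P g) w
        label-walk ε             _               = ε , refl , refl
        label-walk ((_ , j) ◅ w) (g≢0 ∷ nonzero) =
          let w′ , same-vertices , same-length = label-walk w nonzero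
          in label-step j g≢0 ◅ w′ , cong (_ ∷_) same-vertices , cong suc same-length

        label-reflWalk : ∀ {u v} (w : Walk G u v) →
          MapsToWalk (ReflClosure (CayleyAdjacent (nonzeroValues g))) (labeling G 𝒫 P g) w
        label-reflWalk ε             = ε , refl , refl
        label-reflWalk ((_ , j) ◅ w) =
          let w′ , same-vertices , same-length = label-reflWalk w
          in label-reflStep j ◅ w′ , cong (_ ∷_) same-vertices , cong suc same-length

        distances : ∀ {u v} → Walk G u v → ∃[ dCay ] ∃[ dG ]
          IsDistance (CayleyAdjacent (nonzeroValues g)) (labeling G 𝒫 P g u) (labeling G 𝒫 P g v) dCay ×
          IsDistance (Adjacent G) u v dG × dCay ≤ dG
        distances w =
          let dG , isDistG       = distance Fin._≟_ (successor? G) w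
              shortest , len     = IsDistance.attained isDistG
              image , _ , len′   = label-reflWalk shortest
              -- This walk does two things: it bounds the search for the Cayley distance, and its
              -- length bounds that distance.
              w′ , shorter       = contract image
              dCay , isDistCay   = distance _≟ᵛ_ (cayley-successor? g) w′
          in dCay , dG , isDistCay , isDistG ,
             ℕ.≤-trans (IsDistance.minimal isDistCay w′)
               (ℕ.≤-trans shorter (ℕ.≤-reflexive (trans len′ len)))

-- Universal property of the quotient

module _ {A : Fin l → Z₂^ t} {φ : Z₂^ t → Z₂^ k}
         (iso : IsLinearIsomorphism (quotient A) (Z₂^-leftModule k) φ) where
  open LeftModuleMorphisms.IsLeftModuleIsomorphism iso

  private
    section : Z₂^ k → Z₂^ t
    section y = proj₁ (surjective y)

  quotient-section : ∀ y → φ (section y) ≡ y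
  quotient-section y = proj₂ (surjective y) (LeftModule.≈ᴹ-refl (quotient A))

  quotient-kills : ∀ {x} → x ∈Span A → φ x ≡ 0ᵛ
  quotient-kills {x} x∈A = trans
    (⟦⟧-cong {x} {0ᵛ} (subst (_∈Span A) (sym (Z₂^.+ᴹ-identityʳ x)) x∈A)) 0ᴹ-homo

  -- Surjectivity of `φ` in terms of its values on units; both the dimension of their span and the
  -- generation of the Cayley group rest on it.
  quotient-generated : ∀ y → ∃[ x ] extend (φ ∘ unit) x ≡ y
  quotient-generated y = section y , trans (sym (additive≗extend +ᴹ-homo (section y))) (quotient-section y)

  -- Injectivity of `φ` on the quotient puts its kernel inside the span of `A`, which `f` kills.
  -- Hence `f` is constant on the fibres of `φ`, and composing it with any section gives the factor.
  quotient-universal : {f : Z₂^ t → Z₂^ k′} → Additive f → (∀ i → f (A i) ≡ 0ᵛ) →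
    ∃[ T ] IsLinearMap T × (∀ x → f x ≡ T (φ x))
  quotient-universal {f = f} f-+ f-A = T , additive⇒linear T-+ , λ x → f-cong (sym (quotient-section (φ x)))
    where
    T = f ∘ section

    f-cong : ∀ {x y} → φ x ≡ φ y → f x ≡ f y
    f-cong {x} {y} eq = +ᵛ≡0⇒≡ (trans (sym (f-+ x y)) (additive-kills-span f-+ f-A (injective {x} {y} eq)))

    -- `section` need not be additive, but both sides have the same image under `φ`, so `f` cannot
    -- tell them apart.
    T-+ : Additive T
    T-+ x y = trans (f-cong (begin
      φ (section (x +ᵛ y))           ≡⟨ quotient-section (x +ᵛ y) ⟩
      x +ᵛ y                         ≡⟨ cong₂ _+ᵛ_ (quotient-section x) (quotient-section y) ⟨
      φ (section x) +ᵛ φ (section y) ≡⟨ +ᴹ-homo (section x) (section y) ⟨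
      φ (section x +ᵛ section y)     ∎)) (f-+ (section x) (section y))

module _ (G : Graph n m) (𝒫 : Partition m t)
         (B : Fin (cycleRank n m) → Cycle G) (basis : IsCycleBasis G B)
         {φ : Z₂^ t → Z₂^ k} (iso : IsLinearIsomorphism (quotient (parityMatrix G 𝒫 B)) (Z₂^-leftModule k) φ) where
  open LeftModuleMorphisms.IsLeftModuleIsomorphism iso

  -- `φ` evaluates the formal class sum of a cycle, which lies in the row span and so is sent to 0.
  quotient-consistent : Consistent G 𝒫 (φ ∘ unit)
  quotient-consistent C = trans (sym (additive-walkSum G 𝒫 +ᴹ-homo unit (Cycle.walk C)))
                                (quotient-kills iso (cycle∈rowspan G 𝒫 B basis C))

  quotient-mostGeneric : MostGeneric G 𝒫 (φ ∘ unit)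
  quotient-mostGeneric = record
    { consistent = quotient-consistent
    ; universal  = λ g′ consistent′ →
        let T , linear , factor = quotient-universal iso (extend-+ g′) (consistent⇒kills-rows G 𝒫 consistent′ B)
        in T , linear , λ j → trans (sym (extend-unit g′ j)) (factor (unit j))
    }

theorem4 :
    ∀ {n m t ρ : ℕ} (G : Graph n m) → Connected G → (r : Fin n) →
    (𝒫 : Partition m t) (B : Fin (cycleRank n m) → Cycle G) → IsCycleBasis G B →
    let A = parityMatrix G 𝒫 B
        k = t ∸ ρ
    in
    HasRank A ρ →
    ρ ≤ t ×
    (∃[ φ ] IsLinearIsomorphism (quotient A) (Z₂^-leftModule k) φ) ×
    (∀ φ → IsLinearIsomorphism (quotient A) (Z₂^-leftModule k) φ →
      let g = φ ∘ π A ∘ unit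
          S = nonzeroValues g
          Cay = CayleyAdjacent S
      in
      -- (i)
      (MostGeneric G 𝒫 g × HasDimension (_∈Span g) k) ×
      -- (ii)
      ConflictFree G 𝒫 r g ×
      -- (iii)
      IsConnectionSet S ×
      (∀ (P : ∀ v → Path G r v) →
        let lam = labeling G 𝒫 P g in
        (∀ {u v} (p : Path G u v) →
          MapsToWalk (ReflClosure Cay) lam (Path.walk p) ×
          (NonzeroLabels G 𝒫 g (Path.walk p) → MapsToWalk Cay lam (Path.walk p))) ×
        (∀ u v → ∃[ dCay ] ∃[ dG ]
          IsDistance Cay (lam u) (lam v) dCay × IsDistance (Adjacent G) u v dG ×
          dCay ≤ dG × (dCay ≢ dG → dCay < dG) × ¬ (dG < dCay))))
theorem4 {t = t} {ρ} G connected r 𝒫 B basis (v , v-basis)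
  with independent⇒cokernel v (IsBasis.independent v-basis)
... | d , refl , C =
  ℕ.m≤m+n ρ d ,
  -- Matching on `refl` has made `t` equal to `ρ + d`, but `ρ + d ∸ ρ` does not reduce to `d`. Only
  -- this existence claim needs transport, as the rest holds for any isomorphism `φ`.
  subst (λ k → ∃[ φ ] IsLinearIsomorphism (quotient A) (Z₂^-leftModule k) φ) (sym (ℕ.m+n∸m≡n ρ d))
    (Cokernel.map C , cokernel⇒isomorphism v-basis C) ,
  λ φ iso →
    -- `π A` is the identity on representatives and disappears here.
    let g          = φ ∘ unit
        consistent = quotient-consistent G 𝒫 B basis iso
    in (quotient-mostGeneric G 𝒫 B basis iso , surjective⇒dimension g (quotient-generated iso)) ,
       (λ P Q → walkSum-unique G 𝒫 g consistent (Path.walk P) (Path.walk Q)) ,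
       nonzeroValues-isConnectionSet g (quotient-generated iso) ,
       λ P →
         (λ p → label-reflWalk G 𝒫 g consistent P (Path.walk p) , label-walk G 𝒫 g consistent P (Path.walk p)) ,
         λ u v → let dCay , dG , isDistCay , isDistG , dCay≤dG =
                       distances G 𝒫 g consistent P (Path.walk (connected u v))
                 in dCay , dG , isDistCay , isDistG , dCay≤dG , ℕ.≤∧≢⇒< dCay≤dG , ℕ.≤⇒≯ dCay≤dG
  where
  A = parityMatrix G 𝒫 B
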